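{- Let $\Sigma$ be a theory. For each $M \subseteq \mathcal{T}_Y$, $[M]_\Sigma = \bigcup\{[N]_\Sigma \mid N \text{ is a finite subset of } M\}$.
   Context: $Y$ is a non-empty finite set of attributes and $\mathcal{T}_Y = \{y^i \mid y \in Y, i \in \mathbb{Z}\}$. For $M \subseteq \mathcal{T}_Y$ and $j \in \mathbb{Z}$, $M + j = \{y^{i+j} \mid y^i \in M\}$. A formula is $A \Rightarrow B$ with $A,B$ finite subsets of $\mathcal{T}_Y$; $M \models A \Rightarrow B$ means that for every $i \in \mathbb{Z}$, $A+i \subseteq M$ implies $B+i \subseteq M$. A theory is a set of formulas; $\mathrm{Mod}(\Sigma)$ is the set of all $M \subseteq \mathcal{T}_Y$ in which every formula of $\Sigma$ is true. The semantic closure is $[M]_\Sigma = \bigcap\{N \in \mathrm{Mod}(\Sigma) \mid M \subseteq N\}$. -}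

module Defs where

open import Data.Fin.Base using (Fin)
open import Data.Integer.Base using (ℤ; _+_)
open import Data.List.Base using (List)
import Data.List.Membership.Propositional as List
open import Data.Nat.Base using (ℕ; suc)
open import Data.Product using (Σ; ∃; ∃-syntax; _×_; _,_; proj₁)
open import Function.Bundles using (_↔_)
open import Level using (Level; 0ℓ; _⊔_) renaming (suc to lsuc)
open import Relation.Binary.PropositionalEquality using (_≡_)
open import Relation.Unary using (Pred; _∈_; _⊆_; _≐_; ⋂)

private
  variable
    Y : Set
    m s ℓ : Level

NonEmptyFinite : Set → Set
NonEmptyFinite Y = ∃[ n ] (Y ↔ Fin (suc n))

-- The pair (y , i) is the attribute y annotated by the time point i, yⁱ.
𝒯 : Set → Set
𝒯 Y = Y × ℤ

Subset : Set → (ℓ : Level) → Set (lsuc ℓ)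
Subset Y ℓ = Pred (𝒯 Y) ℓ

-- A finite subset is given by a list of its elements; order and repetitions
-- are invisible, since only ⟦_⟧ is ever used.
FinSubset : Set → Set
FinSubset Y = List (𝒯 Y)

⟦_⟧ : FinSubset Y → Subset Y 0ℓ
⟦ F ⟧ t = t List.∈ F

Finite : Subset Y ℓ → Set ℓ
Finite {Y} N = Σ (FinSubset Y) λ F → N ≐ ⟦ F ⟧

shift : Subset Y ℓ → ℤ → Subset Y ℓ
shift M j (y , k) = ∃[ i ] ((y , i) ∈ M × k ≡ i + j)

infix 6 _⇒_
infix 4 _⊨_

record Formula (Y : Set) : Set where
  constructor _⇒_
  field
    antecedent consequent : FinSubset Y

_⊨_ : Subset Y ℓ → Formula Y → Set ℓ
M ⊨ A ⇒ B = ∀ (i : ℤ) → shift ⟦ A ⟧ i ⊆ M → shift ⟦ B ⟧ i ⊆ M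

Theory : Set → (s : Level) → Set (lsuc s)
Theory Y s = Pred (Formula Y) s

Mod : Theory Y s → Pred (Subset Y ℓ) (s ⊔ ℓ)
Mod Γ M = ∀ φ → φ ∈ Γ → M ⊨ φ

-- With predicative universes "all models" means all models N : Subset Y ℓ, at
-- the level of Γ and M; the closure itself then lives one universe higher.
[_]⟨_⟩ : Subset Y ℓ → Theory Y ℓ → Subset Y (lsuc ℓ)
[_]⟨_⟩ {Y} {ℓ} M Γ = ⋂ (Σ (Subset Y ℓ) λ N → N ∈ Mod Γ × M ⊆ N) proj₁

{-# OPTIONS --safe #-}

-- The least model containing M consists of the elements derivable from M by
-- finitary rules. The union of the closures [N] over finite N ⊆ M contains M,
-- and it is itself a model: the antecedent of a formula is finite and the union
-- is directed, so a shifted antecedent contained in the union already lies in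
-- a single [N]. Hence the union contains the least model.

module Submission where

open import Defs
open import Data.Integer.Base using (ℤ)
open import Data.List.Base using ([]; _∷_; _++_)
open import Data.List.Membership.Propositional.Properties using (∈-++⁺ˡ; ∈-++⁺ʳ; ∈-++⁻)
open import Data.List.Relation.Unary.Any using (here; there)
open import Data.Product using (Σ; _×_; _,_; ∃-syntax)
open import Data.Sum using ([_,_]; inj₁; inj₂)
import Data.Sum as Sum
open import Function.Base using (_∘_)
open import Level using (Level; Lift; lift; lower; _⊔_)
open import Relation.Binary.PropositionalEquality using (refl)
open import Relation.Unary using (_∈_; _⊆_; _≐_; _∪_; ⋃)

private
  variable
    ℓ s m n : Level
    Y : Set

-- The union of the closures lives one universe above the models that the
-- closure quantifies over; derivations, being inductive, are minimal at every level.
data Derivable {Y : Set} (Γ : Theory Y s) (M : Subset Y m) : Subset Y (s ⊔ m) where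
  axm  : ∀ {t} → t ∈ M → Derivable Γ M t
  rule : ∀ {A B t} (i : ℤ) → (A ⇒ B) ∈ Γ →
         (∀ {u} → u ∈ shift ⟦ A ⟧ i → Derivable Γ M u) →
         t ∈ shift ⟦ B ⟧ i → Derivable Γ M t

Derivable-model : (Γ : Theory Y s) (M : Subset Y m) → Mod Γ (Derivable Γ M)
Derivable-model Γ M (A ⇒ B) φ∈Γ i A⊆D t∈B = rule i φ∈Γ A⊆D t∈B

Derivable-least : {Γ : Theory Y s} {M : Subset Y m} {N : Subset Y n} →
                  Mod Γ N → M ⊆ N → Derivable Γ M ⊆ N
Derivable-least N-model M⊆N (axm t∈M) = M⊆N t∈M
Derivable-least N-model M⊆N (rule i φ∈Γ A⊆D t∈B) =
  N-model _ φ∈Γ i (λ u∈A → Derivable-least N-model M⊆N (A⊆D u∈A)) t∈B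

closure-mono : (Γ : Theory Y ℓ) {M N : Subset Y ℓ} → M ⊆ N → [ M ]⟨ Γ ⟩ ⊆ [ N ]⟨ Γ ⟩
closure-mono Γ M⊆N t∈[M] (K , K-model , N⊆K) = t∈[M] (K , K-model , N⊆K ∘ M⊆N)

-- Truth passes to intersections: a shifted antecedent inside every model `K` above `M` forces the
-- consequent into each such `K`.
closure-model : (Γ : Theory Y ℓ) (M : Subset Y ℓ) → Mod Γ [ M ]⟨ Γ ⟩
closure-model Γ M φ φ∈Γ i A⊆[M] t∈B K@(_ , K-model , _) =
  K-model φ φ∈Γ i (λ u∈A → A⊆[M] u∈A K) t∈B

-- `Lift` moves a list's subset from level 0 to the level `ℓ` of `Γ`, where its closure can be
-- formed.
Listed : FinSubset Y → Subset Y ℓ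
Listed {ℓ = ℓ} F t = Lift ℓ (t ∈ ⟦ F ⟧)

Listed-finite : (F : FinSubset Y) → Finite (Listed {ℓ = ℓ} F)
Listed-finite F = F , lower , lift

∪-finite : {N K : Subset Y ℓ} → Finite N → Finite K → Finite (N ∪ K)
∪-finite (F , N⊆F , F⊆N) (G , K⊆G , G⊆K) =
  F ++ G , [ ∈-++⁺ˡ ∘ N⊆F , ∈-++⁺ʳ F ∘ K⊆G ] , Sum.map F⊆N G⊆K ∘ ∈-++⁻ F

FinitePart : Subset Y ℓ → Set _
FinitePart {Y} {ℓ} M = Σ (Subset Y ℓ) λ N → Finite N × N ⊆ M

module _ (Γ : Theory Y ℓ) (M : Subset Y ℓ) where

  ⋃-closures : Subset Y _
  ⋃-closures = ⋃ (FinitePart M) λ (N , _) → [ N ]⟨ Γ ⟩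

  M⊆⋃-closures : M ⊆ ⋃-closures
  M⊆⋃-closures {t} t∈M =
    (Listed (t ∷ []) , Listed-finite (t ∷ []) , λ { (lift (here refl)) → t∈M }) ,
    λ (_ , _ , N⊆K) → N⊆K (lift (here refl))

  -- Induction on `A`: the finite parts found for the head and for the tail are joined, and
  -- monotonicity carries both closures into that of their union.
  ⋃-closures-compact : (A : FinSubset Y) (i : ℤ) → shift ⟦ A ⟧ i ⊆ ⋃-closures →
                       ∃[ N ] (Finite N × N ⊆ M × shift ⟦ A ⟧ i ⊆ [ N ]⟨ Γ ⟩)
  ⋃-closures-compact [] i _ =
    Listed [] , Listed-finite [] , (λ { (lift ()) }) , λ { (_ , () , _) }
  ⋃-closures-compact ((y , k) ∷ A) i A⊆⋃
    with A⊆⋃ (k , here refl , refl)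
       | ⋃-closures-compact A i (λ (k′ , p , eq) → A⊆⋃ (k′ , there p , eq))
  ... | (N , N-fin , N⊆M) , a∈[N] | K , K-fin , K⊆M , A⊆[K] =
    N ∪ K , ∪-finite N-fin K-fin , [ N⊆M , K⊆M ] , λ where
      (_ , here refl , refl) → closure-mono Γ {N} {N ∪ K} inj₁ a∈[N]
      (k′ , there p , eq)    → closure-mono Γ {K} {N ∪ K} inj₂ (A⊆[K] (k′ , p , eq))

  ⋃-closures-model : Mod Γ ⋃-closures
  ⋃-closures-model φ@(A ⇒ B) φ∈Γ i A⊆⋃ t∈B
    with N , N-fin , N⊆M , A⊆[N] ← ⋃-closures-compact A i A⊆⋃ =
    (N , N-fin , N⊆M) , closure-model Γ N φ φ∈Γ i A⊆[N] t∈B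

theorem2 : ∀ {ℓ} {Y : Set} → NonEmptyFinite Y → (Γ : Theory Y ℓ) (M : Subset Y ℓ) →
    [ M ]⟨ Γ ⟩ ≐ ⋃ (Σ (Subset Y ℓ) λ N → Finite N × N ⊆ M) λ (N , _) → [ N ]⟨ Γ ⟩
theorem2 _ Γ M =
  -- `⋃-closures` lives too high to be one of the models that `t∈[M]` ranges over. `Derivable Γ M`
  -- is such a model, at level `ℓ`, and its minimality leads on into the union.
  (λ t∈[M] → Derivable-least (⋃-closures-model Γ M) (M⊆⋃-closures Γ M)
               (t∈[M] (Derivable Γ M , Derivable-model Γ M , axm))) ,
  λ ((N , _ , N⊆M) , t∈[N]) → closure-mono Γ {N} {M} N⊆M t∈[N]
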